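{- Let $L$ be either of the sequent calculi $\mathrm{sMC}^*$, $\mathrm{sCN}^*$. The weakening rule (we), "from $\Gamma\Rightarrow\gamma$ infer $\alpha,\Gamma\Rightarrow\gamma$", is admissible in cut-free $L$; that is, for every finite set $\Gamma$ of formulas and all formulas $\alpha,\gamma$, if $\Gamma\Rightarrow\gamma$ is provable in $L-(\mathrm{cut})$, then $\alpha,\Gamma\Rightarrow\gamma$ is provable in $L-(\mathrm{cut})$.
   Context: Formulas are built from countably many propositional variables $p,q,\dots$ using the binary connectives $\land,\lor,\to$ and the unary connective $\sim$. A sequent is an expression $\Gamma\Rightarrow\gamma$ with $\Gamma$ a finite (possibly empty) set of formulas and $\gamma$ a single formula; $\alpha,\Gamma$ means $\{\alpha\}\cup\Gamma$ and $\Gamma,\Delta$ means $\Gamma\cup\Delta$. $L-(\mathrm{cut})$ ("cut-free $L$") is $L$ without the rule (cut). The calculus $\mathrm{sC}$ has the following initial sequents and rules ($p$ any propositional variable; $\alpha,\beta,\gamma$ any formulas; $\Gamma,\Delta,\Sigma$ any finite sets of formulas). Initial sequents: (init1) $p,\Gamma\Rightarrow p$; (init2) $\sim p,\Gamma\Rightarrow\sim p$. (cut): from $\Gamma\Rightarrow\alpha$ and $\alpha,\Sigma\Rightarrow\gamma$ infer $\Gamma,\Sigma\Rightarrow\gamma$. ($\to$left): from $\Gamma\Rightarrow\alpha$ and $\beta,\Delta\Rightarrow\gamma$ infer $\alpha\to\beta,\Gamma,\Delta\Rightarrow\gamma$. ($\to$right): from $\alpha,\Gamma\Rightarrow\beta$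 infer $\Gamma\Rightarrow\alpha\to\beta$. ($\land$left): from $\alpha,\beta,\Gamma\Rightarrow\gamma$ infer $\alpha\land\beta,\Gamma\Rightarrow\gamma$. ($\land$right): from $\Gamma\Rightarrow\alpha$ and $\Gamma\Rightarrow\beta$ infer $\Gamma\Rightarrow\alpha\land\beta$. ($\lor$left): from $\alpha,\Gamma\Rightarrow\gamma$ and $\beta,\Gamma\Rightarrow\gamma$ infer $\alpha\lor\beta,\Gamma\Rightarrow\gamma$. ($\lor$right1), ($\lor$right2): from $\Gamma\Rightarrow\alpha$ (respectively $\Gamma\Rightarrow\beta$) infer $\Gamma\Rightarrow\alpha\lor\beta$. ($\sim$left): from $\alpha,\Gamma\Rightarrow\gamma$ infer $\sim\sim\alpha,\Gamma\Rightarrow\gamma$. ($\sim$right): from $\Gamma\Rightarrow\alpha$ infer $\Gamma\Rightarrow\sim\sim\alpha$. ($\sim\to$left): from $\Gamma\Rightarrow\alpha$ and $\sim\beta,\Delta\Rightarrow\gamma$ infer $\sim(\alpha\to\beta),\Gamma,\Delta\Rightarrow\gamma$. ($\sim\to$right): from $\alpha,\Gamma\Rightarrow\sim\beta$ infer $\Gamma\Rightarrow\sim(\alpha\to\beta)$. ($\sim\land$left): from $\sim\alpha,\Gamma\Rightarrow\gamma$ and $\sim\beta,\Gamma\Rightarrow\gamma$ infer $\sim(\alpha\land\beta),\Gamma\Rightarrow\gamma$. ($\sim\land$right1), ($\sim\land$right2): from $\Gamma\Rightarrow\sim\alpha$ (respectively $\Gamma\Rightarrow\sim\beta$) infer $\Gamma\Rightarrow\sim(\alpha\land\beta)$.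 ($\sim\lor$left): from $\sim\alpha,\sim\beta,\Gamma\Rightarrow\gamma$ infer $\sim(\alpha\lor\beta),\Gamma\Rightarrow\gamma$. ($\sim\lor$right): from $\Gamma\Rightarrow\sim\alpha$ and $\Gamma\Rightarrow\sim\beta$ infer $\Gamma\Rightarrow\sim(\alpha\lor\beta)$. Additional rules: (ex-middle): from $\sim\alpha,\Gamma\Rightarrow\gamma$ and $\alpha,\Gamma\Rightarrow\gamma$ infer $\Gamma\Rightarrow\gamma$. (g-ex-middle): from $\alpha\to\beta,\Gamma\Rightarrow\gamma$ and $\alpha,\Gamma\Rightarrow\gamma$ infer $\Gamma\Rightarrow\gamma$. $\mathrm{sMC}^*=\mathrm{sC}+$(g-ex-middle); $\mathrm{sCN}^*=\mathrm{sC}+$(ex-middle)$+$(g-ex-middle). -}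

module Defs where

open import Data.List.Base using (List; []; _∷_; _++_)
open import Data.List.Membership.Propositional using () renaming (_∈_ to _∈ˡ_)
open import Data.List.Relation.Binary.BagAndSetEquality using (_∼[_]_; set)
open import Data.List.Relation.Unary.All using (All)
open import Data.Nat.Base using (ℕ)
open import Data.Product.Base using (_×_)
open import Level using (0ℓ)
open import Relation.Binary.PropositionalEquality using (_≡_)
open import Relation.Unary using (Pred; _∈_; _∪_; _∖_; ｛_｝)

infix  25 ∼_
infixr 22 _∧_
infixr 21 _∨_
infixr 20 _⊃_
infix  3  _⇒_
infix  2  _≈_ _⊢_

data Formula : Set where
  var         : ℕ → Formula
  _∧_ _∨_ _⊃_ : Formula → Formula → Formula
  ∼_          : Formula → Formula

-- A list stands for the finite set of its elements: `_∷_` is α,Γ, `_++_` is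
-- Γ,Δ, and antecedents are only ever compared by `_≈_`.
record Sequent : Set where
  constructor _⇒_
  field
    antecedent : List Formula
    succedent  : Formula

open Sequent public

_≈_ : Sequent → Sequent → Set
s ≈ t = (antecedent s ∼[ set ] antecedent t) × (succedent s ≡ succedent t)

data RuleName : Set where
  init1 init2 cut                    : RuleName
  ⊃left ⊃right                       : RuleName
  ∧left ∧right                       : RuleName
  ∨left ∨right1 ∨right2              : RuleName
  ∼left ∼right                       : RuleName
  ∼⊃left ∼⊃right                     : RuleName
  ∼∧left ∼∧right1 ∼∧right2           : RuleName
  ∼∨left ∼∨right                     : RuleName
  ex-middle g-ex-middle              : RuleName

-- `Instance r ps c`: the premises ps yield the conclusion c by one
-- application of r.
data Instance : RuleName → List Sequent → Sequent → Set where
  init1 : ∀ p Γ → Instance init1 [] (var p ∷ Γ ⇒ var p)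
  init2 : ∀ p Γ → Instance init2 [] (∼ var p ∷ Γ ⇒ ∼ var p)

  cut : ∀ Γ Σ α γ →
    Instance cut ((Γ ⇒ α) ∷ (α ∷ Σ ⇒ γ) ∷ []) (Γ ++ Σ ⇒ γ)

  ⊃left : ∀ Γ Δ α β γ →
    Instance ⊃left ((Γ ⇒ α) ∷ (β ∷ Δ ⇒ γ) ∷ []) (α ⊃ β ∷ Γ ++ Δ ⇒ γ)
  ⊃right : ∀ Γ α β →
    Instance ⊃right ((α ∷ Γ ⇒ β) ∷ []) (Γ ⇒ α ⊃ β)

  ∧left : ∀ Γ α β γ →
    Instance ∧left ((α ∷ β ∷ Γ ⇒ γ) ∷ []) (α ∧ β ∷ Γ ⇒ γ)
  ∧right : ∀ Γ α β →
    Instance ∧right ((Γ ⇒ α) ∷ (Γ ⇒ β) ∷ []) (Γ ⇒ α ∧ β)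

  ∨left : ∀ Γ α β γ →
    Instance ∨left ((α ∷ Γ ⇒ γ) ∷ (β ∷ Γ ⇒ γ) ∷ []) (α ∨ β ∷ Γ ⇒ γ)
  ∨right1 : ∀ Γ α β → Instance ∨right1 ((Γ ⇒ α) ∷ []) (Γ ⇒ α ∨ β)
  ∨right2 : ∀ Γ α β → Instance ∨right2 ((Γ ⇒ β) ∷ []) (Γ ⇒ α ∨ β)

  ∼left : ∀ Γ α γ →
    Instance ∼left ((α ∷ Γ ⇒ γ) ∷ []) (∼ (∼ α) ∷ Γ ⇒ γ)
  ∼right : ∀ Γ α → Instance ∼right ((Γ ⇒ α) ∷ []) (Γ ⇒ ∼ (∼ α))

  ∼⊃left : ∀ Γ Δ α β γ →
    Instance ∼⊃left ((Γ ⇒ α) ∷ (∼ β ∷ Δ ⇒ γ) ∷ []) (∼ (α ⊃ β) ∷ Γ ++ Δ ⇒ γ)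
  ∼⊃right : ∀ Γ α β →
    Instance ∼⊃right ((α ∷ Γ ⇒ ∼ β) ∷ []) (Γ ⇒ ∼ (α ⊃ β))

  ∼∧left : ∀ Γ α β γ →
    Instance ∼∧left ((∼ α ∷ Γ ⇒ γ) ∷ (∼ β ∷ Γ ⇒ γ) ∷ []) (∼ (α ∧ β) ∷ Γ ⇒ γ)
  ∼∧right1 : ∀ Γ α β → Instance ∼∧right1 ((Γ ⇒ ∼ α) ∷ []) (Γ ⇒ ∼ (α ∧ β))
  ∼∧right2 : ∀ Γ α β → Instance ∼∧right2 ((Γ ⇒ ∼ β) ∷ []) (Γ ⇒ ∼ (α ∧ β))

  ∼∨left : ∀ Γ α β γ →
    Instance ∼∨left ((∼ α ∷ ∼ β ∷ Γ ⇒ γ) ∷ []) (∼ (α ∨ β) ∷ Γ ⇒ γ)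
  ∼∨right : ∀ Γ α β →
    Instance ∼∨right ((Γ ⇒ ∼ α) ∷ (Γ ⇒ ∼ β) ∷ []) (Γ ⇒ ∼ (α ∨ β))

  ex-middle : ∀ Γ α γ →
    Instance ex-middle ((∼ α ∷ Γ ⇒ γ) ∷ (α ∷ Γ ⇒ γ) ∷ []) (Γ ⇒ γ)
  g-ex-middle : ∀ Γ α β γ →
    Instance g-ex-middle ((α ⊃ β ∷ Γ ⇒ γ) ∷ (α ∷ Γ ⇒ γ) ∷ []) (Γ ⇒ γ)

Calculus : Set₁
Calculus = Pred RuleName 0ℓ

sC : Calculus
sC = _∈ˡ init1 ∷ init2 ∷ cut
       ∷ ⊃left ∷ ⊃right
       ∷ ∧left ∷ ∧right
       ∷ ∨left ∷ ∨right1 ∷ ∨right2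
       ∷ ∼left ∷ ∼right
       ∷ ∼⊃left ∷ ∼⊃right
       ∷ ∼∧left ∷ ∼∧right1 ∷ ∼∧right2
       ∷ ∼∨left ∷ ∼∨right ∷ []

sMC* : Calculus
sMC* = sC ∪ ｛ g-ex-middle ｝

sCN* : Calculus
sCN* = sC ∪ ｛ ex-middle ｝ ∪ ｛ g-ex-middle ｝

_-cut : Calculus → Calculus
L -cut = L ∖ ｛ cut ｝

-- The step `c ≈ s` identifies sequents whose antecedents are the same set, so
-- provability depends only on the set represented by a list.
data _⊢_ (L : Calculus) : Sequent → Set where
  infer : ∀ {r ps c s} →
    r ∈ L → Instance r ps c → c ≈ s → All (L ⊢_) ps → L ⊢ s

{-# OPTIONS --safe #-}
-- Every rule instance stays an instance of the same rule, up to equality of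
-- antecedents as sets, when one formula δ is added to the antecedents of all
-- its premises and its conclusion. In the rules joining two contexts Γ, Δ the
-- formula is added to both, and the two copies are identified in Γ ∪ Δ.
-- Weakening follows by induction on derivations.
module Submission where

open import Defs
open import Data.List.Base using (List; []; _∷_; _++_; map)
open import Data.List.Relation.Binary.BagAndSetEquality using (set; [_]-Equality; bag-=⇒; ↭⇒∼bag; ++-cong; ++-idempotent; ∷-cong)
open import Data.List.Relation.Binary.Permutation.Propositional using (_↭_; ↭-refl; ↭-trans; prep; swap)
open import Data.List.Relation.Binary.Permutation.Propositional.Properties using (shift)
open import Data.List.Relation.Binary.Pointwise.Base using (Pointwise; []; _∷_)
open import Data.List.Relation.Unary.All using (All; []; _∷_)
open import Data.Product.Base using (_×_; _,_; ∃₂)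
open import Data.Sum.Base using (_⊎_)
open import Relation.Binary.Bundles using (Setoid)
open import Relation.Binary.PropositionalEquality using (_≡_; refl; trans)

private
  variable
    L : Calculus
    r : RuleName
    s t u : Sequent
    ps qs : List Sequent

  module SetEq = Setoid ([ set ]-Equality Formula)

≈-refl : s ≈ s
≈-refl = SetEq.refl , refl

≈-trans : s ≈ t → t ≈ u → s ≈ u
≈-trans (p , e) (q , f) = SetEq.trans p q , trans e f

↭⇒≈ : ∀ {Γ Δ γ} → Γ ↭ Δ → (Γ ⇒ γ) ≈ (Δ ⇒ γ)
↭⇒≈ p = bag-=⇒ (↭⇒∼bag p) , refl

weaken : Formula → Sequent → Sequent
weaken δ (Γ ⇒ γ) = δ ∷ Γ ⇒ γ

weaken-cong : ∀ δ → s ≈ t → weaken δ s ≈ weaken δ t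
weaken-cong δ (p , e) = ∷-cong refl p , e

exchange : ∀ α δ {Γ γ} → (α ∷ δ ∷ Γ ⇒ γ) ≈ (δ ∷ α ∷ Γ ⇒ γ)
exchange α δ = ↭⇒≈ (swap α δ ↭-refl)

-- Serves `∧left` and `∼∨left`, whose premise has two active formulas in front of the context.
exchange₂ : ∀ δ α β {Γ γ} → (δ ∷ α ∷ β ∷ Γ ⇒ γ) ≈ (α ∷ β ∷ δ ∷ Γ ⇒ γ)
exchange₂ δ α β = ↭⇒≈ (↭-trans (swap δ α ↭-refl) (prep α (swap δ β ↭-refl)))

-- A permutation brings the copies of `δ` together; merging them is an equality of sets, not of
-- multisets.
contract-++ : ∀ δ Γ Δ {γ} → (δ ∷ Γ ++ δ ∷ Δ ⇒ γ) ≈ (δ ∷ Γ ++ Δ ⇒ γ)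
contract-++ δ Γ Δ = ≈-trans
  (↭⇒≈ (prep δ (shift δ Γ Δ)))
  (++-cong (++-idempotent (δ ∷ [])) SetEq.refl , refl)

-- Here `ε` is the principal formula of `⊃left` or `∼⊃left`.
contract-∷-++ : ∀ δ ε Γ Δ {γ} → (ε ∷ δ ∷ Γ ++ δ ∷ Δ ⇒ γ) ≈ (δ ∷ ε ∷ Γ ++ Δ ⇒ γ)
contract-∷-++ δ ε Γ Δ =
  ≈-trans (weaken-cong ε (contract-++ δ Γ Δ)) (exchange ε δ)

-- In each case `δ` joins the context, behind the active and principal formulas, so the match with
-- `weaken δ` is only up to `≈`. Keeping `r` fixed lets the proof of `r ∈ L` be reused.
weaken-instance : ∀ δ → Instance r ps s →
  ∃₂ λ qs t → Instance r qs t × (t ≈ weaken δ s) × Pointwise _≈_ (map (weaken δ) ps) qs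
weaken-instance δ (init1 p Γ) =
  _ , _ , init1 p (δ ∷ Γ) , exchange _ δ , []
weaken-instance δ (init2 p Γ) =
  _ , _ , init2 p (δ ∷ Γ) , exchange _ δ , []
weaken-instance δ (cut Γ Σ α γ) =
  _ , _ , cut (δ ∷ Γ) (δ ∷ Σ) α γ , contract-++ δ Γ Σ , ≈-refl ∷ exchange δ _ ∷ []
weaken-instance δ (⊃left Γ Δ α β γ) =
  _ , _ , ⊃left (δ ∷ Γ) (δ ∷ Δ) α β γ , contract-∷-++ δ _ Γ Δ , ≈-refl ∷ exchange δ _ ∷ []
weaken-instance δ (⊃right Γ α β) =
  _ , _ , ⊃right (δ ∷ Γ) α β , ≈-refl , exchange δ _ ∷ []
weaken-instance δ (∧left Γ α β γ) =
  _ , _ , ∧left (δ ∷ Γ) α β γ , exchange _ δ , exchange₂ δ _ _ ∷ []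
weaken-instance δ (∧right Γ α β) =
  _ , _ , ∧right (δ ∷ Γ) α β , ≈-refl , ≈-refl ∷ ≈-refl ∷ []
weaken-instance δ (∨left Γ α β γ) =
  _ , _ , ∨left (δ ∷ Γ) α β γ , exchange _ δ , exchange δ _ ∷ exchange δ _ ∷ []
weaken-instance δ (∨right1 Γ α β) =
  _ , _ , ∨right1 (δ ∷ Γ) α β , ≈-refl , ≈-refl ∷ []
weaken-instance δ (∨right2 Γ α β) =
  _ , _ , ∨right2 (δ ∷ Γ) α β , ≈-refl , ≈-refl ∷ []
weaken-instance δ (∼left Γ α γ) =
  _ , _ , ∼left (δ ∷ Γ) α γ , exchange _ δ , exchange δ _ ∷ []
weaken-instance δ (∼right Γ α) =
  _ , _ , ∼right (δ ∷ Γ) α , ≈-refl , ≈-refl ∷ []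
weaken-instance δ (∼⊃left Γ Δ α β γ) =
  _ , _ , ∼⊃left (δ ∷ Γ) (δ ∷ Δ) α β γ , contract-∷-++ δ _ Γ Δ , ≈-refl ∷ exchange δ _ ∷ []
weaken-instance δ (∼⊃right Γ α β) =
  _ , _ , ∼⊃right (δ ∷ Γ) α β , ≈-refl , exchange δ _ ∷ []
weaken-instance δ (∼∧left Γ α β γ) =
  _ , _ , ∼∧left (δ ∷ Γ) α β γ , exchange _ δ , exchange δ _ ∷ exchange δ _ ∷ []
weaken-instance δ (∼∧right1 Γ α β) =
  _ , _ , ∼∧right1 (δ ∷ Γ) α β , ≈-refl , ≈-refl ∷ []
weaken-instance δ (∼∧right2 Γ α β) =
  _ , _ , ∼∧right2 (δ ∷ Γ) α β , ≈-refl , ≈-refl ∷ []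
weaken-instance δ (∼∨left Γ α β γ) =
  _ , _ , ∼∨left (δ ∷ Γ) α β γ , exchange _ δ , exchange₂ δ _ _ ∷ []
weaken-instance δ (∼∨right Γ α β) =
  _ , _ , ∼∨right (δ ∷ Γ) α β , ≈-refl , ≈-refl ∷ ≈-refl ∷ []
weaken-instance δ (ex-middle Γ α γ) =
  _ , _ , ex-middle (δ ∷ Γ) α γ , ≈-refl , exchange δ _ ∷ exchange δ _ ∷ []
weaken-instance δ (g-ex-middle Γ α β γ) =
  _ , _ , g-ex-middle (δ ∷ Γ) α β γ , ≈-refl , exchange δ _ ∷ exchange δ _ ∷ []

-- Every inference already ends in a step `c ≈ s`, so only the last one has to be adjusted.
⊢-resp-≈ : s ≈ t → L ⊢ s → L ⊢ t
⊢-resp-≈ s≈t (infer r∈L i c≈s ds) = infer r∈L i (≈-trans c≈s s≈t) ds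

mutual
  ⊢-weaken : ∀ δ → L ⊢ s → L ⊢ weaken δ s
  ⊢-weaken δ (infer r∈L i c≈s ds) with weaken-instance δ i
  ... | _ , _ , i′ , c′≈ , ps≈qs =
    -- The new conclusion equals the weakened `c`, hence the weakened `s`.
    infer r∈L i′ (≈-trans c′≈ (weaken-cong δ c≈s)) (⊢-weaken-All δ ps≈qs ds)

  -- Explicit recursion over the premises keeps the induction visibly structural.
  ⊢-weaken-All : ∀ δ → Pointwise _≈_ (map (weaken δ) ps) qs →
    All (L ⊢_) ps → All (L ⊢_) qs
  ⊢-weaken-All δ []            []       = []
  ⊢-weaken-All δ (p≈q ∷ ps≈qs) (d ∷ ds) =
    ⊢-resp-≈ p≈q (⊢-weaken δ d) ∷ ⊢-weaken-All δ ps≈qs ds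

proposition2p11 : (L : Calculus) → L ≡ sMC* ⊎ L ≡ sCN* →
    (Γ : List Formula) (α γ : Formula) →
    (L -cut) ⊢ (Γ ⇒ γ) → (L -cut) ⊢ (α ∷ Γ ⇒ γ)
-- The new derivation repeats the rule names of the old one, so cut cannot enter.
proposition2p11 L _ Γ α γ = ⊢-weaken α
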